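{- For $i\ge 1$ let $P_i$ denote a rectangle of dimensions $\frac{1}{i}\times\frac{1}{i+1}$ (so $\sum_{i=1}^{\infty}\frac{1}{i(i+1)}=1$). Let $n\ge 1000$ be an integer and suppose that the rectangles $P_1,\dots,P_{n-1}$ can be packed into the unit square. Then all the rectangles $P_1,P_2,P_3,\dots$ can be packed into the square of side length $1+\frac{1}{n}$. Moreover, the region actually used by this packing (the unit square together with the additional strips) has area less than $1+\frac{2}{n}\left(\ln 2+\frac{1}{2n}\right)$.
   Context: A packing of rectangles into a container means placing the rectangles (translated, and possibly rotated by $90^\circ$) inside the container so that they have pairwise disjoint interiors. -}

module Defs where

open import Data.Nat as ℕ using (ℕ; zero; suc; NonZero)
import Data.Nat.Properties as ℕ
open import Data.Nat.Solver using () renaming (module +-*-Solver to ℕ-Solver)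
open import Data.Integer as ℤ using (+_; -[1+_]; +[1+_]; +<+; +≤+)
import Data.Integer.Properties as ℤ
open import Data.Rational as ℚ using (ℚ; 0ℚ; 1ℚ; ½; mkℚ; toℚᵘ; fromℚᵘ)
import Data.Rational.Properties as ℚ
open import Data.Rational.Solver using () renaming (module +-*-Solver to ℚ-Solver)
open import Data.Rational.Unnormalised as ℚᵘ using (mkℚᵘ)
import Data.Rational.Unnormalised.Properties as ℚᵘ
open import Data.List using (List; []; _∷_; map; foldr)
open import Data.List.Relation.Unary.All using (All)
open import Data.List.Relation.Unary.Any using (Any)
open import Data.List.Relation.Unary.AllPairs using (AllPairs)
open import Data.Product using (Σ-syntax; ∃-syntax; _×_; _,_; proj₁; proj₂; swap)
open import Data.Sum using (inj₁; inj₂)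
open import Relation.Nullary using (¬_)
open import Relation.Binary.PropositionalEquality

Cauchy : (ℕ → ℚ) → Set
Cauchy x = ∀ ε → 0ℚ ℚ.< ε →
  ∃[ N ] ∀ m n → N ℕ.≤ m → N ℕ.≤ n → ℚ.∣ x m ℚ.- x n ∣ ℚ.< ε

record ℝ : Set where
  constructor mkℝ
  field
    seq    : ℕ → ℚ
    cauchy : Cauchy seq

open ℝ public

infix 4 _<_ _≤_

_<_ : ℝ → ℝ → Set
x < y = ∃[ ε ] 0ℚ ℚ.< ε × (∃[ N ] ∀ n → N ℕ.≤ n → seq x n ℚ.+ ε ℚ.≤ seq y n)

-- Constructively equivalent to ¬ (y < x).
_≤_ : ℝ → ℝ → Set
x ≤ y = ∀ ε → 0ℚ ℚ.< ε → ∃[ N ] ∀ n → N ℕ.≤ n → seq x n ℚ.≤ seq y n ℚ.+ ε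

fromℚ : ℚ → ℝ
fromℚ q = mkℝ (λ _ → q) λ ε 0<ε → 0 , λ _ _ _ _ →
  subst (ℚ._< ε) (sym (cong ℚ.∣_∣ (ℚ.+-inverseʳ q))) 0<ε

module CauchyProperties where

  half : ∀ ε → ε ℚ.* ½ ℚ.+ ε ℚ.* ½ ≡ ε
  half ε = trans (sym (ℚ.*-distribˡ-+ ε ½ ½)) (ℚ.*-identityʳ ε)

  half-pos : ∀ ε → 0ℚ ℚ.< ε → 0ℚ ℚ.< ε ℚ.* ½
  half-pos ε 0<ε = subst (ℚ._< ε ℚ.* ½) (ℚ.*-zeroˡ ½) (ℚ.*-monoˡ-<-pos ½ 0<ε)

  opaque
    +-cauchy : ∀ x y → Cauchy (λ n → seq x n ℚ.+ seq y n)
    +-cauchy x y ε 0<ε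
      with cauchy x (ε ℚ.* ½) (half-pos ε 0<ε) | cauchy y (ε ℚ.* ½) (half-pos ε 0<ε)
    ... | N₁ , p | N₂ , q = N₁ ℕ.⊔ N₂ , λ m n N≤m N≤n → begin-strict
      ℚ.∣ (seq x m ℚ.+ seq y m) ℚ.- (seq x n ℚ.+ seq y n) ∣
        ≡⟨ cong ℚ.∣_∣ (rearrange (seq x m) (seq y m) (seq x n) (seq y n)) ⟩
      ℚ.∣ (seq x m ℚ.- seq x n) ℚ.+ (seq y m ℚ.- seq y n) ∣
        ≤⟨ ℚ.∣p+q∣≤∣p∣+∣q∣ (seq x m ℚ.- seq x n) (seq y m ℚ.- seq y n) ⟩
      ℚ.∣ seq x m ℚ.- seq x n ∣ ℚ.+ ℚ.∣ seq y m ℚ.- seq y n ∣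
        <⟨ ℚ.+-mono-< (p m n (ℕ.m⊔n≤o⇒m≤o N₁ N₂ N≤m) (ℕ.m⊔n≤o⇒m≤o N₁ N₂ N≤n))
                      (q m n (ℕ.m⊔n≤o⇒n≤o N₁ N₂ N≤m) (ℕ.m⊔n≤o⇒n≤o N₁ N₂ N≤n)) ⟩
      ε ℚ.* ½ ℚ.+ ε ℚ.* ½
        ≡⟨ half ε ⟩
      ε ∎
      where
      open ℚ.≤-Reasoning
      rearrange : ∀ a b c d → (a ℚ.+ b) ℚ.- (c ℚ.+ d) ≡ (a ℚ.- c) ℚ.+ (b ℚ.- d)
      rearrange = solve 4 (λ a b c d → (a :+ b) :- (c :+ d) := (a :- c) :+ (b :- d)) refl
        where open ℚ-Solver

  bounded : ∀ x → ∃[ B ] ℚ.Positive B × (∃[ N ] ∀ n → N ℕ.≤ n → ℚ.∣ seq x n ∣ ℚ.≤ B)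
  bounded x with cauchy x 1ℚ (ℚ.positive⁻¹ 1ℚ)
  ... | N , p = ℚ.∣ a ∣ ℚ.+ 1ℚ
              , ℚ.nonNeg+pos⇒pos ℚ.∣ a ∣ {{ℚ.∣-∣-nonNeg a}} 1ℚ
              , N , λ n N≤n → begin
    ℚ.∣ seq x n ∣
      ≡⟨ cong ℚ.∣_∣ (split a (seq x n)) ⟩
    ℚ.∣ a ℚ.+ (seq x n ℚ.- a) ∣
      ≤⟨ ℚ.∣p+q∣≤∣p∣+∣q∣ a (seq x n ℚ.- a) ⟩
    ℚ.∣ a ∣ ℚ.+ ℚ.∣ seq x n ℚ.- a ∣
      ≤⟨ ℚ.+-monoʳ-≤ ℚ.∣ a ∣ (ℚ.<⇒≤ (p n N N≤n ℕ.≤-refl)) ⟩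
    ℚ.∣ a ∣ ℚ.+ 1ℚ ∎
    where
    open ℚ.≤-Reasoning
    a = seq x N
    split : ∀ a b → b ≡ a ℚ.+ (b ℚ.- a)
    split = solve 2 (λ a b → b := a :+ (b :- a)) refl
      where open ℚ-Solver

  divide : ∀ C → ℚ.Positive C → ∀ ε → 0ℚ ℚ.< ε → ∃[ δ ] 0ℚ ℚ.< δ × C ℚ.* δ ≡ ε
  divide C C>0 ε 0<ε = r ℚ.* ε , 0<δ , eq
    where
    r = ℚ.1/_ C {{ℚ.pos⇒nonZero C {{C>0}}}}
    0<δ : 0ℚ ℚ.< r ℚ.* ε
    0<δ = subst (ℚ._< r ℚ.* ε) (ℚ.*-zeroʳ r) (ℚ.*-monoʳ-<-pos r {{ℚ.1/pos⇒pos C {{C>0}}}} 0<ε)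
    eq : C ℚ.* (r ℚ.* ε) ≡ ε
    eq = trans (sym (ℚ.*-assoc C r ε))
        (trans (cong (ℚ._* ε) (ℚ.*-inverseʳ C {{ℚ.pos⇒nonZero C {{C>0}}}})) (ℚ.*-identityˡ ε))

  ∣*∣< : ∀ a b K δ → ℚ.Positive K → ℚ.∣ a ∣ ℚ.≤ K → ℚ.∣ b ∣ ℚ.< δ → ℚ.∣ a ℚ.* b ∣ ℚ.< K ℚ.* δ
  ∣*∣< a b K δ K>0 a≤K b<δ = begin-strict
    ℚ.∣ a ℚ.* b ∣         ≡⟨ ℚ.∣p*q∣≡∣p∣*∣q∣ a b ⟩
    ℚ.∣ a ∣ ℚ.* ℚ.∣ b ∣   ≤⟨ ℚ.*-monoʳ-≤-nonNeg ℚ.∣ b ∣ {{ℚ.∣-∣-nonNeg b}} a≤K ⟩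
    K ℚ.* ℚ.∣ b ∣         <⟨ ℚ.*-monoʳ-<-pos K {{K>0}} b<δ ⟩
    K ℚ.* δ               ∎
    where open ℚ.≤-Reasoning

  *-close : ∀ a b c d A B δ → ℚ.Positive A → ℚ.Positive B → ℚ.∣ a ∣ ℚ.≤ A → ℚ.∣ d ∣ ℚ.≤ B →
            ℚ.∣ a ℚ.- c ∣ ℚ.< δ → ℚ.∣ b ℚ.- d ∣ ℚ.< δ →
            ℚ.∣ a ℚ.* b ℚ.- c ℚ.* d ∣ ℚ.< (A ℚ.+ B) ℚ.* δ
  *-close a b c d A B δ A>0 B>0 a≤A d≤B a-c b-d = begin-strict
    ℚ.∣ a ℚ.* b ℚ.- c ℚ.* d ∣
      ≡⟨ cong ℚ.∣_∣ (rearrange a b c d) ⟩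
    ℚ.∣ a ℚ.* (b ℚ.- d) ℚ.+ d ℚ.* (a ℚ.- c) ∣
      ≤⟨ ℚ.∣p+q∣≤∣p∣+∣q∣ (a ℚ.* (b ℚ.- d)) (d ℚ.* (a ℚ.- c)) ⟩
    ℚ.∣ a ℚ.* (b ℚ.- d) ∣ ℚ.+ ℚ.∣ d ℚ.* (a ℚ.- c) ∣
      <⟨ ℚ.+-mono-< (∣*∣< a (b ℚ.- d) A δ A>0 a≤A b-d) (∣*∣< d (a ℚ.- c) B δ B>0 d≤B a-c) ⟩
    A ℚ.* δ ℚ.+ B ℚ.* δ
      ≡⟨ ℚ.*-distribʳ-+ δ A B ⟨
    (A ℚ.+ B) ℚ.* δ ∎
    where
    open ℚ.≤-Reasoning
    rearrange : ∀ a b c d → a ℚ.* b ℚ.- c ℚ.* d ≡ a ℚ.* (b ℚ.- d) ℚ.+ d ℚ.* (a ℚ.- c)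
    rearrange = solve 4 (λ a b c d → a :* b :- c :* d := a :* (b :- d) :+ d :* (a :- c)) refl
      where open ℚ-Solver

  opaque
    *-cauchy : ∀ x y → Cauchy (λ n → seq x n ℚ.* seq y n)
    *-cauchy x y ε 0<ε = from-bounds (bounded x) (bounded y)
      where
      xy : ℕ → ℚ
      xy = λ n → seq x n ℚ.* seq y n
      Goal : Set
      Goal = ∃[ N ] ∀ m n → N ℕ.≤ m → N ℕ.≤ n → ℚ.∣ xy m ℚ.- xy n ∣ ℚ.< ε
      Bound : ℝ → Set
      Bound = λ z → ∃[ B ] ℚ.Positive B × (∃[ N ] ∀ n → N ℕ.≤ n → ℚ.∣ seq z n ∣ ℚ.≤ B)
      Close : ℝ → ℚ → Set
      Close = λ z δ → ∃[ N ] ∀ m n → N ℕ.≤ m → N ℕ.≤ n → ℚ.∣ seq z m ℚ.- seq z n ∣ ℚ.< δ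

      from-close : ((A , _) : Bound x) ((B , _) : Bound y) → ∀ δ → (A ℚ.+ B) ℚ.* δ ≡ ε →
                   Close x δ → Close y δ → Goal
      from-close (A , A>0 , N₁ , boundA) (B , B>0 , N₂ , boundB) δ eq (N₃ , p) (N₄ , q) =
        N₁₂ ℕ.⊔ N₃₄ , λ m n N≤m N≤n →
        let m₁₂ = ℕ.m⊔n≤o⇒m≤o N₁₂ N₃₄ N≤m
            n₁₂ = ℕ.m⊔n≤o⇒m≤o N₁₂ N₃₄ N≤n
            m₃₄ = ℕ.m⊔n≤o⇒n≤o N₁₂ N₃₄ N≤m
            n₃₄ = ℕ.m⊔n≤o⇒n≤o N₁₂ N₃₄ N≤n
        in subst (ℚ.∣ xy m ℚ.- xy n ∣ ℚ.<_) eq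
             (*-close (seq x m) (seq y m) (seq x n) (seq y n) A B δ A>0 B>0
               (boundA m (ℕ.m⊔n≤o⇒m≤o N₁ N₂ m₁₂)) (boundB n (ℕ.m⊔n≤o⇒n≤o N₁ N₂ n₁₂))
               (p m n (ℕ.m⊔n≤o⇒m≤o N₃ N₄ m₃₄) (ℕ.m⊔n≤o⇒m≤o N₃ N₄ n₃₄))
               (q m n (ℕ.m⊔n≤o⇒n≤o N₃ N₄ m₃₄) (ℕ.m⊔n≤o⇒n≤o N₃ N₄ n₃₄)))
        where
        N₁₂ N₃₄ : ℕ
        N₁₂ = N₁ ℕ.⊔ N₂
        N₃₄ = N₃ ℕ.⊔ N₄

      from-bounds : Bound x → Bound y → Goal
      from-bounds a@(A , A>0 , _) b@(B , B>0 , _) =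
        let δ , 0<δ , eq = divide (A ℚ.+ B) (ℚ.pos+pos⇒pos A {{A>0}} B {{B>0}}) ε 0<ε
        in from-close a b δ eq (cauchy x δ 0<δ) (cauchy y δ 0<δ)

open CauchyProperties using (+-cauchy; *-cauchy)

infixl 6 _+_
infixl 7 _*_ _/_

_+_ : ℝ → ℝ → ℝ
x + y = mkℝ (λ n → seq x n ℚ.+ seq y n) (+-cauchy x y)

_*_ : ℝ → ℝ → ℝ
x * y = mkℝ (λ n → seq x n ℚ.* seq y n) (*-cauchy x y)

_/_ : (a b : ℕ) .{{_ : NonZero b}} → ℝ
a / b = fromℚ (+ a ℚ./ b)

0ℝ 1ℝ : ℝ
0ℝ = fromℚ 0ℚ
1ℝ = fromℚ 1ℚ

-- The natural logarithm of a positive integer, ln b = ∫₁ᵇ dt/t.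
-- With d = b - 1 and the partition of [1, b] into N equal parts of
-- length d/N, the right-endpoint Riemann sum is
--   ∑_{k=1}^{N} (d/N) · 1/(1 + kd/N) = ∑_{k=1}^{N} d/(N + kd),
-- and ln b is the limit of these sums as N → ∞.

∑ : ℕ → (ℕ → ℚ) → ℚ
∑ zero    f = 0ℚ
∑ (suc n) f = ∑ n f ℚ.+ f n

-- (d/N) · 1/(1 + kd/N) for N = suc N-1
slice : (d N-1 k : ℕ) → ℚ
slice d N-1 k = + d ℚ./ (suc N-1 ℕ.+ k ℕ.* d)

rightSum leftSum : (d N-1 : ℕ) → ℚ
rightSum d N-1 = ∑ (suc N-1) (λ k → slice d N-1 (suc k))
leftSum  d N-1 = ∑ (suc N-1) (slice d N-1)

module SumProperties where

  /-≤ : ∀ a b c d .{{_ : NonZero b}} .{{_ : NonZero d}} →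
        a ℕ.* d ℕ.≤ c ℕ.* b → + a ℚ./ b ℚ.≤ + c ℚ./ d
  /-≤ a (suc b) c (suc d) h = ℚ.toℚᵘ-cancel-≤
    (ℚᵘ.≤-respˡ-≃ (ℚᵘ.≃-sym (ℚ.toℚᵘ-fromℚᵘ (mkℚᵘ (+ a) b)))
    (ℚᵘ.≤-respʳ-≃ (ℚᵘ.≃-sym (ℚ.toℚᵘ-fromℚᵘ (mkℚᵘ (+ c) d)))
    (ℚᵘ.*≤* (subst₂ ℤ._≤_ (ℤ.pos-* a (suc d)) (ℤ.pos-* c (suc b)) (+≤+ h)))))

  /-+ : ∀ a b q .{{_ : NonZero q}} → + a ℚ./ q ℚ.+ + b ℚ./ q ≡ + (a ℕ.+ b) ℚ./ q
  /-+ a b (suc q) = ℚ.toℚᵘ-injective (ℚᵘ.≃-trans (ℚ.toℚᵘ-homo-+ (+ a ℚ./ suc q) (+ b ℚ./ suc q))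
    (ℚᵘ.≃-trans (ℚᵘ.+-cong (ℚ.toℚᵘ-fromℚᵘ (mkℚᵘ (+ a) q)) (ℚ.toℚᵘ-fromℚᵘ (mkℚᵘ (+ b) q)))
    (ℚᵘ.≃-trans (ℚᵘ.*≡* eq) (ℚᵘ.≃-sym (ℚ.toℚᵘ-fromℚᵘ (mkℚᵘ (+ (a ℕ.+ b)) q))))))
    where
    Q = + suc q
    eq : (+ a ℤ.* Q ℤ.+ + b ℤ.* Q) ℤ.* Q ≡ + (a ℕ.+ b) ℤ.* + (suc q ℕ.* suc q)
    eq = trans (cong (ℤ._* Q) (sym (ℤ.*-distribʳ-+ Q (+ a) (+ b))))
        (trans (ℤ.*-assoc (+ (a ℕ.+ b)) Q Q)
               (cong (+ (a ℕ.+ b) ℤ.*_) (sym (ℤ.pos-* (suc q) (suc q)))))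

  ∑-mono : ∀ n {f g} → (∀ k → k ℕ.< n → f k ℚ.≤ g k) → ∑ n f ℚ.≤ ∑ n g
  ∑-mono zero    h = ℚ.≤-refl
  ∑-mono (suc n) h = ℚ.+-mono-≤ (∑-mono n (λ k k<n → h k (ℕ.m<n⇒m<1+n k<n))) (h n ℕ.≤-refl)

  ∑-cong : ∀ n {f g} → (∀ k → f k ≡ g k) → ∑ n f ≡ ∑ n g
  ∑-cong zero    h = refl
  ∑-cong (suc n) h = cong₂ ℚ._+_ (∑-cong n h) (h n)

  ∑-split : ∀ m n f → ∑ (m ℕ.+ n) f ≡ ∑ m f ℚ.+ ∑ n (λ k → f (m ℕ.+ k))
  ∑-split m zero    f rewrite ℕ.+-identityʳ m = sym (ℚ.+-identityʳ (∑ m f))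
  ∑-split m (suc n) f rewrite ℕ.+-suc m n | ∑-split m n f =
    ℚ.+-assoc (∑ m f) (∑ n (λ k → f (m ℕ.+ k))) (f (m ℕ.+ n))

  ∑-blocks : ∀ n m f → ∑ (n ℕ.* m) f ≡ ∑ n (λ i → ∑ m (λ j → f (i ℕ.* m ℕ.+ j)))
  ∑-blocks zero    m f = refl
  ∑-blocks (suc n) m f rewrite ℕ.+-comm m (n ℕ.* m) | ∑-split (n ℕ.* m) m f =
    cong (ℚ._+ ∑ m (λ j → f (n ℕ.* m ℕ.+ j))) (∑-blocks n m f)

  ∑-shift : ∀ n f → ∑ n f ℚ.+ f n ≡ ∑ n (λ k → f (suc k)) ℚ.+ f 0
  ∑-shift zero    f = refl
  ∑-shift (suc n) f = trans (cong (ℚ._+ f (suc n)) (∑-shift n f))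
    (swapʳ (∑ n (λ k → f (suc k))) (f 0) (f (suc n)))
    where
    swapʳ : ∀ a b c → a ℚ.+ b ℚ.+ c ≡ a ℚ.+ c ℚ.+ b
    swapʳ = solve 3 (λ a b c → a :+ b :+ c := a :+ c :+ b) refl
      where open ℚ-Solver

  ∑-const : ∀ m d q .{{_ : NonZero q}} → ∑ m (λ _ → + d ℚ./ q) ≡ + (m ℕ.* d) ℚ./ q
  ∑-const zero d q@(suc _) = ℚ.≤-antisym (/-≤ 0 1 0 q ℕ.≤-refl) (/-≤ 0 q 0 1 ℕ.≤-refl)
  ∑-const (suc m) d q = trans (cong (ℚ._+ (+ d ℚ./ q)) (∑-const m d q))
    (trans (/-+ (m ℕ.* d) d q) (cong (λ a → + a ℚ./ q) (ℕ.+-comm (m ℕ.* d) d)))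

  ∑-refine : ∀ m d q .{{_ : NonZero m}} .{{_ : NonZero q}} →
             ∑ m (λ _ → (+ d ℚ./ (m ℕ.* q)) {{ℕ.m*n≢0 m q}}) ≡ + d ℚ./ q
  ∑-refine m@(suc _) d q@(suc _) = trans (∑-const m d (m ℕ.* q))
    (ℚ.≤-antisym (/-≤ (m ℕ.* d) (m ℕ.* q) d q (ℕ.≤-reflexive eq))
                 (/-≤ d q (m ℕ.* d) (m ℕ.* q) (ℕ.≤-reflexive (sym eq))))
    where
    eq : m ℕ.* d ℕ.* q ≡ d ℕ.* (m ℕ.* q)
    eq = solve 3 (λ m d q → m :* d :* q := d :* (m :* q)) refl m d q
      where open ℕ-Solver

  -- suc a * suc b ≡ suc (prod-1 a b)
  prod-1 : ℕ → ℕ → ℕ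
  prod-1 a b = b ℕ.+ a ℕ.* suc b

  rightSum-refine : ∀ d a b → rightSum d a ℚ.≤ rightSum d (prod-1 a b)
  rightSum-refine d a b = subst (rightSum d a ℚ.≤_)
    (sym (∑-blocks (suc a) (suc b) (λ k → slice d (prod-1 a b) (suc k))))
    (∑-mono (suc a) λ i _ → subst (ℚ._≤ ∑ (suc b) (λ j → slice d (prod-1 a b) (suc (i ℕ.* suc b ℕ.+ j))))
      (∑-refine (suc b) d (suc a ℕ.+ suc i ℕ.* d))
      (∑-mono (suc b) λ j j<m →
        /-≤ d (suc b ℕ.* (suc a ℕ.+ suc i ℕ.* d))
            d (suc (prod-1 a b) ℕ.+ suc (i ℕ.* suc b ℕ.+ j) ℕ.* d)
            (ℕ.*-monoʳ-≤ d (begin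
              suc a ℕ.* suc b ℕ.+ suc (i ℕ.* suc b ℕ.+ j) ℕ.* d
                ≡⟨ cong (λ z → suc a ℕ.* suc b ℕ.+ z ℕ.* d) (ℕ.+-suc (i ℕ.* suc b) j) ⟨
              suc a ℕ.* suc b ℕ.+ (i ℕ.* suc b ℕ.+ suc j) ℕ.* d
                ≤⟨ ℕ.+-monoʳ-≤ (suc a ℕ.* suc b) (ℕ.*-monoˡ-≤ d (ℕ.+-monoʳ-≤ (i ℕ.* suc b) j<m)) ⟩
              suc a ℕ.* suc b ℕ.+ (i ℕ.* suc b ℕ.+ suc b) ℕ.* d
                ≡⟨ solve 4 (λ A B i d → A :* B :+ (i :* B :+ B) :* d := B :* (A :+ (con 1 :+ i) :* d))
                     refl (suc a) (suc b) i d ⟩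
              suc b ℕ.* (suc a ℕ.+ suc i ℕ.* d) ∎))))
    where
    open ℕ.≤-Reasoning
    open ℕ-Solver

  leftSum-refine : ∀ d a b → leftSum d (prod-1 a b) ℚ.≤ leftSum d a
  leftSum-refine d a b = subst (ℚ._≤ leftSum d a)
    (sym (∑-blocks (suc a) (suc b) (slice d (prod-1 a b))))
    (∑-mono (suc a) λ i _ → subst (∑ (suc b) (λ j → slice d (prod-1 a b) (i ℕ.* suc b ℕ.+ j)) ℚ.≤_)
      (∑-refine (suc b) d (suc a ℕ.+ i ℕ.* d))
      (∑-mono (suc b) λ j _ →
        /-≤ d (suc (prod-1 a b) ℕ.+ (i ℕ.* suc b ℕ.+ j) ℕ.* d)
            d (suc b ℕ.* (suc a ℕ.+ i ℕ.* d))
            (ℕ.*-monoʳ-≤ d (begin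
              suc b ℕ.* (suc a ℕ.+ i ℕ.* d)
                ≡⟨ solve 4 (λ A B i d → B :* (A :+ i :* d) := A :* B :+ i :* B :* d)
                     refl (suc a) (suc b) i d ⟩
              suc a ℕ.* suc b ℕ.+ i ℕ.* suc b ℕ.* d
                ≤⟨ ℕ.+-monoʳ-≤ (suc a ℕ.* suc b) (ℕ.*-monoˡ-≤ d (ℕ.m≤m+n (i ℕ.* suc b) j)) ⟩
              suc a ℕ.* suc b ℕ.+ (i ℕ.* suc b ℕ.+ j) ℕ.* d ∎))))
    where
    open ℕ.≤-Reasoning
    open ℕ-Solver

  slice-antitone : ∀ d N k → slice d N (suc k) ℚ.≤ slice d N k
  slice-antitone d N k =
    /-≤ d (suc N ℕ.+ suc k ℕ.* d) d (suc N ℕ.+ k ℕ.* d)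
        (ℕ.*-monoʳ-≤ d (ℕ.+-monoʳ-≤ (suc N) (ℕ.*-monoˡ-≤ d (ℕ.n≤1+n k))))

  rightSum≤leftSum : ∀ d M N → rightSum d M ℚ.≤ leftSum d N
  rightSum≤leftSum d M N = begin
    rightSum d M             ≤⟨ rightSum-refine d M N ⟩
    rightSum d (prod-1 M N)  ≤⟨ ∑-mono (suc (prod-1 M N)) (λ k _ → slice-antitone d (prod-1 M N) k) ⟩
    leftSum d (prod-1 M N)   ≡⟨ cong (leftSum d) (ℕ.suc-injective (ℕ.*-comm (suc M) (suc N))) ⟩
    leftSum d (prod-1 N M)   ≤⟨ leftSum-refine d N M ⟩
    leftSum d N              ∎
    where open ℚ.≤-Reasoning

  leftSum≤ : ∀ d N → leftSum d N ℚ.≤ rightSum d N ℚ.+ + d ℚ./ suc N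
  leftSum≤ d N = begin
    leftSum d N
      ≡⟨ ℚ.+-identityʳ (leftSum d N) ⟨
    leftSum d N ℚ.+ 0ℚ
      ≤⟨ ℚ.+-monoʳ-≤ (leftSum d N) (/-≤ 0 1 d (suc N ℕ.+ suc N ℕ.* d) ℕ.z≤n) ⟩
    leftSum d N ℚ.+ slice d N (suc N)
      ≡⟨ ∑-shift (suc N) (slice d N) ⟩
    rightSum d N ℚ.+ slice d N 0
      ≤⟨ ℚ.+-monoʳ-≤ (rightSum d N)
           (/-≤ d (suc N ℕ.+ 0) d (suc N) (ℕ.≤-reflexive (cong (d ℕ.*_) (sym (ℕ.+-identityʳ (suc N)))))) ⟩
    rightSum d N ℚ.+ + d ℚ./ suc N ∎
    where open ℚ.≤-Reasoning

  archimedean : ∀ d ε → 0ℚ ℚ.< ε → ∃[ K ] ∀ N → K ℕ.≤ N → + d ℚ./ suc N ℚ.< ε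
  archimedean d (mkℚ (+ zero) q _) (ℚ.*<* (+<+ ()))
  archimedean d (mkℚ -[1+ p ] q _) (ℚ.*<* ())
  archimedean d (mkℚ +[1+ p ] q c) _ = d ℕ.* suc q , λ N K≤N →
    ℚ.toℚᵘ-cancel-< (ℚᵘ.<-respˡ-≃ (ℚᵘ.≃-sym (ℚ.toℚᵘ-fromℚᵘ (mkℚᵘ (+ d) N)))
      (ℚᵘ.*<* (subst₂ ℤ._<_ (ℤ.pos-* d (suc q)) (ℤ.pos-* (suc p) (suc N))
        (+<+ (ℕ.<-≤-trans (ℕ.s≤s K≤N) (ℕ.m≤m+n (suc N) (p ℕ.* suc N)))))))

  ∣-∣< : ∀ a b ε → a ℚ.- b ℚ.< ε → b ℚ.- a ℚ.< ε → ℚ.∣ a ℚ.- b ∣ ℚ.< ε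
  ∣-∣< a b ε h₁ h₂ with ℚ.∣p∣≡p∨∣p∣≡-p (a ℚ.- b)
  ... | inj₁ e = subst (ℚ._< ε) (sym e) h₁
  ... | inj₂ e = subst (ℚ._< ε) (sym (trans e (flip a b))) h₂
    where
    flip : ∀ a b → ℚ.- (a ℚ.- b) ≡ b ℚ.- a
    flip = solve 2 (λ a b → :- (a :- b) := b :- a) refl
      where open ℚ-Solver

  opaque
    rightSum-cauchy : ∀ d → Cauchy (rightSum d)
    rightSum-cauchy d ε 0<ε with archimedean d ε 0<ε
    ... | K , p = K , λ m n K≤m K≤n →
      ∣-∣< (rightSum d m) (rightSum d n) ε (close m n K≤n) (close n m K≤m)
      where
      open ℚ.≤-Reasoning
      cancel : ∀ a b → a ℚ.+ b ℚ.- a ≡ b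
      cancel = solve 2 (λ a b → a :+ b :- a := b) refl
        where open ℚ-Solver
      close : ∀ m n → K ℕ.≤ n → rightSum d m ℚ.- rightSum d n ℚ.< ε
      close m n K≤n = begin-strict
        rightSum d m ℚ.- rightSum d n
          ≤⟨ ℚ.+-monoˡ-≤ (ℚ.- rightSum d n)
               (ℚ.≤-trans (rightSum≤leftSum d m n) (leftSum≤ d n)) ⟩
        rightSum d n ℚ.+ + d ℚ./ suc n ℚ.- rightSum d n
          ≡⟨ cancel (rightSum d n) (+ d ℚ./ suc n) ⟩
        + d ℚ./ suc n
          <⟨ p n K≤n ⟩
        ε ∎

open SumProperties using (rightSum-cauchy)

ln : (b : ℕ) .{{_ : NonZero b}} → ℝ
ln (suc d) = mkℝ (rightSum d) (rightSum-cauchy d)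

Point : Set
Point = ℝ × ℝ

record Rect : Set where
  constructor rect
  field
    corner : Point     -- lower-left
    width  : ℝ
    height : ℝ

open Rect public

NonDegenerate : Rect → Set
NonDegenerate R = 0ℝ < width R × 0ℝ < height R

infix 4 _∈_ _∈°_ _⊆_

_∈_ : Point → Rect → Set
(u , v) ∈ rect (x , y) w h = (x ≤ u × u ≤ x + w) × (y ≤ v × v ≤ y + h)

_∈°_ : Point → Rect → Set
(u , v) ∈° rect (x , y) w h = (x < u × u < x + w) × (y < v × v < y + h)

_⊆_ : Rect → Rect → Set
R ⊆ S = ∀ p → p ∈ R → p ∈ S

DisjointInteriors : Rect → Rect → Set
DisjointInteriors R S = ∀ p → ¬ (p ∈° R × p ∈° S)

area : Rect → ℝ
area R = width R * height R

square : ℝ → Rect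
square s = rect (0ℝ , 0ℝ) s s

data Orientation : Set where
  unrotated rotated : Orientation

orient : Orientation → ℝ × ℝ → ℝ × ℝ
orient unrotated wh = wh
orient rotated   wh = swap wh

record Packing {I : Set} (dims : I → ℝ × ℝ) (C : Rect) : Set where
  field
    position    : I → Point
    orientation : I → Orientation

  placed : I → Rect
  placed i = let (w , h) = orient (orientation i) (dims i) in rect (position i) w h

  field
    inside   : ∀ i → placed i ⊆ C
    disjoint : ∀ i j → i ≢ j → DisjointInteriors (placed i) (placed j)

open Packing public using (placed)

P : (i : ℕ) .{{_ : NonZero i}} → ℝ × ℝ
P i = 1 / i , 1 / suc i

-- The index k stands for the rectangle P (suc k).
PackingAll : Rect → Set
PackingAll = Packing {ℕ} (λ k → P (suc k))

-- The region used by a packing of all the P i in C: the unit square, which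
-- holds P 1, …, P (n - 1), together with finitely many additional strips
-- holding the others.  These pieces do not overlap, so that the area of the
-- region is the sum of their areas.
record UsedRegion (n : ℕ) {C : Rect} (p : PackingAll C) : Set where
  field
    strips : List Rect

  pieces : List Rect
  pieces = square 1ℝ ∷ strips

  field
    nonDegenerate  : All NonDegenerate strips
    pieces-inside  : All (_⊆ C) pieces
    nonOverlapping : AllPairs DisjointInteriors pieces
    in-square      : ∀ k → suc k ℕ.< n → placed p k ⊆ square 1ℝ
    in-strip       : ∀ k → n ℕ.≤ suc k → Any (placed p k ⊆_) strips

regionArea : {n : ℕ} {C : Rect} {p : PackingAll C} → UsedRegion n p → ℝ
regionArea U = foldr _+_ 0ℝ (map area (UsedRegion.pieces U))

{-# OPTIONS --safe #-}

-- Put M_j = 2^j n and sort the rectangles P_i with i ≥ n into levels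
-- M_j ≤ i < 2 M_j.  Placed side by side along their sides 1/(i+1), those of
-- level j fill a row of length ∑_{M_j < i ≤ 2 M_j} 1/i, which is the M_j-th
-- right Riemann sum of ln 2 and hence at most ln 2, and of thickness 1/M_j.
-- Level 0 thus fits into a strip ln 2 × 1/n on top of the unit square.  In a
-- strip of the same size to the right of it, level j ≥ 1 takes the distances
-- from 1/M_j to 2/M_j from the square.  The strips have total area 2 ln 2 / n.

module Submission where

open import Defs
open import Data.Nat as ℕ using (ℕ; zero; suc; _∸_; NonZero)
open import Data.Nat.Properties using (m*n≢0)
import Data.Nat.Properties as ℕ
open import Data.Integer using (+_)
open import Data.Rational as ℚ using (ℚ; 0ℚ; 1ℚ; ½)
import Data.Rational.Properties as ℚ
open import Data.Rational.Solver using () renaming (module +-*-Solver to ℚ-Solver)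
open import Data.Fin using (Fin; toℕ; fromℕ<)
import Data.Fin.Properties as Fin
open import Data.List using ([]; _∷_)
open import Data.List.Relation.Unary.All using ([]; _∷_)
open import Data.List.Relation.Unary.Any using (Any; here; there)
open import Data.List.Relation.Unary.AllPairs using ([]; _∷_)
open import Data.Product using (Σ-syntax; _×_; _,_; proj₁; proj₂)
open import Data.Sum using (inj₁; inj₂)
open import Function using (_∘_)
open import Relation.Nullary using (¬_; yes; no; contradiction)
open import Relation.Binary.Definitions using (Tri; tri<; tri≈; tri>)
open import Relation.Binary.PropositionalEquality

open CauchyProperties using (half; half-pos)
open SumProperties

-- Order of the real numbers.

pointwise : ∀ {x y} → (∀ n → seq x n ℚ.≤ seq y n) → x ≤ y
pointwise {x} {y} h ε 0<ε = 0 , λ n _ → ℚ.≤-trans (h n)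
  (subst (ℚ._≤ seq y n ℚ.+ ε) (ℚ.+-identityʳ (seq y n)) (ℚ.+-monoʳ-≤ (seq y n) (ℚ.<⇒≤ 0<ε)))

≤-trans : ∀ {x y z} → x ≤ y → y ≤ z → x ≤ z
≤-trans {x} {y} {z} x≤y y≤z ε 0<ε
  with x≤y (ε ℚ.* ½) (half-pos ε 0<ε) | y≤z (ε ℚ.* ½) (half-pos ε 0<ε)
... | N₁ , p | N₂ , q = N₁ ℕ.⊔ N₂ , λ n N≤n → begin
  seq x n
    ≤⟨ p n (ℕ.m⊔n≤o⇒m≤o N₁ N₂ N≤n) ⟩
  seq y n ℚ.+ ε ℚ.* ½
    ≤⟨ ℚ.+-monoˡ-≤ (ε ℚ.* ½) (q n (ℕ.m⊔n≤o⇒n≤o N₁ N₂ N≤n)) ⟩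
  seq z n ℚ.+ ε ℚ.* ½ ℚ.+ ε ℚ.* ½
    ≡⟨ ℚ.+-assoc (seq z n) (ε ℚ.* ½) (ε ℚ.* ½) ⟩
  seq z n ℚ.+ (ε ℚ.* ½ ℚ.+ ε ℚ.* ½)
    ≡⟨ cong (seq z n ℚ.+_) (half ε) ⟩
  seq z n ℚ.+ ε ∎
  where open ℚ.≤-Reasoning

<⇒≤ : ∀ {x y} → x < y → x ≤ y
<⇒≤ {x} {y} (δ , 0<δ , N , p) ε 0<ε = N , λ n N≤n → begin
  seq x n          ≡⟨ ℚ.+-identityʳ (seq x n) ⟨
  seq x n ℚ.+ 0ℚ   ≤⟨ ℚ.+-monoʳ-≤ (seq x n) (ℚ.<⇒≤ 0<δ) ⟩
  seq x n ℚ.+ δ    ≤⟨ p n N≤n ⟩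
  seq y n          ≡⟨ ℚ.+-identityʳ (seq y n) ⟨
  seq y n ℚ.+ 0ℚ   ≤⟨ ℚ.+-monoʳ-≤ (seq y n) (ℚ.<⇒≤ 0<ε) ⟩
  seq y n ℚ.+ ε    ∎
  where open ℚ.≤-Reasoning

<⇒≱ : ∀ {x y} → x < y → ¬ (y ≤ x)
<⇒≱ {x} {y} (δ , 0<δ , N₁ , p) y≤x with y≤x (δ ℚ.* ½) (half-pos δ 0<δ)
-- Past both thresholds, the gap `δ` would have to fit into the tolerance `δ * ½`.
... | N₂ , q = ℚ.<-irrefl refl (begin-strict
  seq x N ℚ.+ δ                       ≤⟨ p N (ℕ.m≤m⊔n N₁ N₂) ⟩
  seq y N                             ≤⟨ q N (ℕ.m≤n⊔m N₁ N₂) ⟩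
  seq x N ℚ.+ δ ℚ.* ½                 ≡⟨ cong (seq x N ℚ.+_) (ℚ.+-identityʳ (δ ℚ.* ½)) ⟨
  seq x N ℚ.+ (δ ℚ.* ½ ℚ.+ 0ℚ)        <⟨ ℚ.+-monoʳ-< (seq x N) (ℚ.+-monoʳ-< (δ ℚ.* ½) (half-pos δ 0<δ)) ⟩
  seq x N ℚ.+ (δ ℚ.* ½ ℚ.+ δ ℚ.* ½)   ≡⟨ cong (seq x N ℚ.+_) (half δ) ⟩
  seq x N ℚ.+ δ                       ∎)
  where
  open ℚ.≤-Reasoning
  N = N₁ ℕ.⊔ N₂

-- Edges of rectangles, inclusion and disjoint interiors.

left right bottom top : Rect → ℝ
left   R = proj₁ (corner R)
right  R = left R + width R
bottom R = proj₂ (corner R)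
top    R = bottom R + height R

⊆-from-edges : ∀ {R S} → left S ≤ left R → right R ≤ right S →
               bottom S ≤ bottom R → top R ≤ top S → R ⊆ S
⊆-from-edges {R} {S} l r b t (u , v) ((xu , ux) , (yv , vy)) =
    (≤-trans {left S} {left R} {u} l xu , ≤-trans {u} {right R} {right S} ux r)
  , (≤-trans {bottom S} {bottom R} {v} b yv , ≤-trans {v} {top R} {top S} vy t)

⊆-trans : ∀ {R S T} → R ⊆ S → S ⊆ T → R ⊆ T
⊆-trans R⊆S S⊆T p = S⊆T p ∘ R⊆S p

∈°⇒∈ : ∀ {p R} → p ∈° R → p ∈ R
∈°⇒∈ {u , v} {R} ((a , b) , (c , d)) =
    (<⇒≤ {left R} {u} a , <⇒≤ {u} {right R} b)
  , (<⇒≤ {bottom R} {v} c , <⇒≤ {v} {top R} d)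

-- The interior of R need not be compared with that of S: the strict
-- inequality comes from T alone.
disjoint-right : ∀ {R T} S → R ⊆ S → right S ≤ left T → DisjointInteriors R T
disjoint-right {R} {T} S R⊆S s≤t p@(u , _) (p∈R , ((t<u , _) , _)) =
  <⇒≱ {left T} {u} t<u
    (≤-trans {u} {right S} {left T} (proj₂ (proj₁ (R⊆S p (∈°⇒∈ {p} {R} p∈R)))) s≤t)

disjoint-above : ∀ {R T} S → R ⊆ S → top S ≤ bottom T → DisjointInteriors R T
disjoint-above {R} {T} S R⊆S s≤t p@(_ , v) (p∈R , (_ , (t<v , _))) =
  <⇒≱ {bottom T} {v} t<v
    (≤-trans {v} {top S} {bottom T} (proj₂ (proj₂ (R⊆S p (∈°⇒∈ {p} {R} p∈R)))) s≤t)

disjoint-sym : ∀ {R S} → DisjointInteriors R S → DisjointInteriors S R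
disjoint-sym d p (p∈S , p∈R) = d p (p∈R , p∈S)

-- Bounds for ln 2.

-- No right sum exceeds any left sum, by common refinement, and the left sum with `suc N` parts
-- exceeds the right one by at most 1/(N+1), which tends to 0.
rightSum≤ln2 : ∀ M → fromℚ (rightSum 1 M) ≤ ln 2
rightSum≤ln2 M ε 0<ε with archimedean 1 ε 0<ε
... | K , p = K , λ N K≤N → begin
  rightSum 1 M                      ≤⟨ rightSum≤leftSum 1 M N ⟩
  leftSum 1 N                       ≤⟨ leftSum≤ 1 N ⟩
  rightSum 1 N ℚ.+ + 1 ℚ./ suc N    ≤⟨ ℚ.+-monoʳ-≤ (rightSum 1 N) (ℚ.<⇒≤ (p N K≤N)) ⟩
  rightSum 1 N ℚ.+ ε                ∎
  where open ℚ.≤-Reasoning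

0<ln2 : 0ℝ < ln 2
-- ½ is the right sum with a single part, which every other right sum refines.
0<ln2 = ½ , ℚ.positive⁻¹ ½ , 0 , λ N _ →
  subst (λ z → ½ ℚ.≤ rightSum 1 z) (ℕ.+-identityʳ N) (rightSum-refine 1 0 N)

ln2≤1 : ∀ N → seq (ln 2) N ℚ.≤ 1ℚ
-- The left sum with a single part is 1.
ln2≤1 N = rightSum≤leftSum 1 N 0

-- Unit fractions and rows of rectangles.

0≤1/ : ∀ a .{{_ : NonZero a}} → 0ℚ ℚ.≤ + 1 ℚ./ a
0≤1/ a = /-≤ 0 1 1 a ℕ.z≤n

1/-antitone : ∀ a b .{{_ : NonZero a}} .{{_ : NonZero b}} → a ℕ.≤ b → + 1 ℚ./ b ℚ.≤ + 1 ℚ./ a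
1/-antitone a b a≤b = /-≤ 1 b 1 a (ℕ.*-monoʳ-≤ 1 a≤b)

1/+1/≤1/ : ∀ q a b .{{_ : NonZero a}} .{{_ : NonZero b}} → suc q ℕ.+ suc q ℕ.≤ a → suc q ℕ.+ suc q ℕ.≤ b →
           + 1 ℚ./ a ℚ.+ + 1 ℚ./ b ℚ.≤ + 1 ℚ./ suc q
1/+1/≤1/ q a b 2q≤a 2q≤b = begin
  + 1 ℚ./ a ℚ.+ + 1 ℚ./ b      ≤⟨ ℚ.+-mono-≤ (1/-antitone 2q a 2q≤a) (1/-antitone 2q b 2q≤b) ⟩
  + 1 ℚ./ 2q ℚ.+ + 1 ℚ./ 2q    ≡⟨ /-+ 1 1 2q ⟩
  + 2 ℚ./ 2q                   ≤⟨ /-≤ 2 2q 1 (suc q) (ℕ.≤-reflexive eq) ⟩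
  + 1 ℚ./ suc q                ∎
  where
  open ℚ.≤-Reasoning
  2q = suc q ℕ.+ suc q
  eq : 2 ℕ.* suc q ≡ 1 ℕ.* 2q
  eq = trans (cong (suc q ℕ.+_) (ℕ.+-identityʳ (suc q))) (sym (ℕ.*-identityˡ 2q))

≤+ʳ : ∀ p q → 0ℚ ℚ.≤ q → p ℚ.≤ p ℚ.+ q
≤+ʳ p q 0≤q = subst (ℚ._≤ p ℚ.+ q) (ℚ.+-identityʳ p) (ℚ.+-monoʳ-≤ p 0≤q)

∑-monoˡ-≤ : ∀ {f} → (∀ k → 0ℚ ℚ.≤ f k) → ∀ {m n} → m ℕ.≤ n → ∑ m f ℚ.≤ ∑ n f
∑-monoˡ-≤ {f} f≥0 {m} {n} m≤n with ℕ.m≤n⇒∃[o]m+o≡n m≤n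
... | o , refl = go o
  where
  go : ∀ o → ∑ m f ℚ.≤ ∑ (m ℕ.+ o) f
  go zero    rewrite ℕ.+-identityʳ m = ℚ.≤-refl
  go (suc o) rewrite ℕ.+-suc m o = ℚ.≤-trans (go o) (≤+ʳ (∑ (m ℕ.+ o) f) (f (m ℕ.+ o)) (f≥0 (m ℕ.+ o)))

-- In the row of the P_i with i ≥ suc M, the distance of P_{suc (M + t)} from
-- the start.
offset : (M t : ℕ) → ℚ
offset M t = ∑ t (λ k → slice 1 M (suc k))

0≤slice : ∀ M k → 0ℚ ℚ.≤ slice 1 M (suc k)
0≤slice M k = 0≤1/ (suc M ℕ.+ suc k ℕ.* 1)

0≤offset : ∀ M t → 0ℚ ℚ.≤ offset M t
0≤offset M t = ∑-monoˡ-≤ (0≤slice M) {0} {t} ℕ.z≤n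

-- The summand with index `t` is the side 1/(i+1) of P_i for i = `suc (M + t)`, and the later
-- summands are nonnegative.
offset-step : ∀ M {t u} → t ℕ.< u → offset M t ℚ.+ + 1 ℚ./ suc (suc (M ℕ.+ t)) ℚ.≤ offset M u
offset-step M {t} {u} t<u = ℚ.≤-trans
  (ℚ.+-monoʳ-≤ (offset M t) (1/-antitone (suc M ℕ.+ suc t ℕ.* 1) (suc (suc (M ℕ.+ t))) (ℕ.≤-reflexive eq)))
  (∑-monoˡ-≤ (0≤slice M) t<u)
  where
  eq : suc M ℕ.+ suc t ℕ.* 1 ≡ suc (suc (M ℕ.+ t))
  eq = cong suc (trans (cong (M ℕ.+_) (ℕ.*-identityʳ (suc t))) (ℕ.+-suc M t))

-- A full row of `suc M` rectangles has length `offset M (suc M)`, which is by definition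
-- `rightSum 1 M`. The summand `0ℝ` matches the far edge of a strip that starts at 0.
offset-end : ∀ M {t} → t ℕ.< suc M → fromℚ (offset M t) + 1 / suc (suc (M ℕ.+ t)) ≤ 0ℝ + ln 2
offset-end M {t} t<M =
  ≤-trans {end} {fromℚ (rightSum 1 M)} {0ℝ + ln 2} (pointwise {end} {fromℚ (rightSum 1 M)} λ _ → offset-step M t<M)
    (≤-trans {fromℚ (rightSum 1 M)} {ln 2} {0ℝ + ln 2} (rightSum≤ln2 M)
      (pointwise {ln 2} {0ℝ + ln 2} λ N → ℚ.≤-reflexive (sym (ℚ.+-identityˡ (seq (ln 2) N)))))
  where
  end = fromℚ (offset M t) + 1 / suc (suc (M ℕ.+ t))

-- Division of the indices into levels.

module Levels (m : ℕ) where

  -- Level j consists of the P_i with suc (size-1 j) ≤ i < 2 * suc (size-1 j),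
  -- where suc (size-1 j) = 2 ^ j * n.
  size-1 : ℕ → ℕ
  size-1 zero    = m
  size-1 (suc j) = size-1 j ℕ.+ suc (size-1 j)

  size-1-double : ∀ {j l} → j ℕ.< l → suc (size-1 j) ℕ.+ suc (size-1 j) ℕ.≤ suc (size-1 l)
  size-1-double {j} {suc l} (ℕ.s≤s j≤l) with ℕ.m≤n⇒m<n∨m≡n j≤l
  ... | inj₂ refl = ℕ.≤-refl
  ... | inj₁ j<l  = ℕ.≤-trans (size-1-double j<l) (ℕ.m≤m+n (suc (size-1 l)) (suc (size-1 l)))

  m≤size-1 : ∀ j → m ℕ.≤ size-1 j
  m≤size-1 zero    = ℕ.≤-refl
  m≤size-1 (suc j) = ℕ.≤-trans (m≤size-1 j) (ℕ.m≤m+n (size-1 j) (suc (size-1 j)))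

  -- In `outer j t`, P (suc k) has place `t` of level `j`, counted from 0. The equations are
  -- arguments, so that a position can be read off a view without matching on them.
  data View (k : ℕ) : Set where
    inner : (f : Fin m) → k ≡ toℕ f → View k
    outer : (j t : ℕ) → t ℕ.< suc (size-1 j) → k ≡ size-1 j ℕ.+ t → View k

  next : ∀ {o} → (Σ[ j ∈ ℕ ] Σ[ t ∈ ℕ ] t ℕ.< suc (size-1 j) × o ≡ size-1 j ℕ.+ t) →
         Σ[ j ∈ ℕ ] Σ[ t ∈ ℕ ] t ℕ.< suc (size-1 j) × suc o ≡ size-1 j ℕ.+ t
  next (j , t , t<M , refl) with ℕ.m≤n⇒m<n∨m≡n t<M
  ... | inj₁ 1+t<M = j , suc t , 1+t<M , sym (ℕ.+-suc (size-1 j) t)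
  -- The place `t` was the last of level `j`; its successor, `size-1 j + suc (size-1 j)`, opens
  -- level `suc j`.
  ... | inj₂ refl  = suc j , 0 , ℕ.s≤s ℕ.z≤n ,
    trans (sym (ℕ.+-suc (size-1 j) (size-1 j))) (sym (ℕ.+-identityʳ (size-1 (suc j))))

  locate : ∀ o → Σ[ j ∈ ℕ ] Σ[ t ∈ ℕ ] t ℕ.< suc (size-1 j) × o ℕ.+ m ≡ size-1 j ℕ.+ t
  locate zero    = 0 , 0 , ℕ.s≤s ℕ.z≤n , sym (ℕ.+-identityʳ m)
  locate (suc o) = next (locate o)

  view : ∀ k → View k
  view k with k ℕ.<? m
  ... | yes k<m = inner (fromℕ< k<m) (sym (Fin.toℕ-fromℕ< k<m))
  ... | no  k≮m with locate (k ∸ m)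
  ...   | j , t , t<M , eq = outer j t t<M (trans (sym (ℕ.m∸n+n≡m (ℕ.≮⇒≥ k≮m))) eq)

-- Placement of the rectangles in the strips.

module Construction (m : ℕ) (given : Packing {Fin m} (λ k → P (suc (toℕ k))) (square 1ℝ)) where

  open Levels m

  module Given = Packing given

  n = suc m

  positionOf : ∀ {k} → View k → Point
  positionOf (inner f _)           = Given.position f
  positionOf (outer zero    t _ _) = fromℚ (offset (size-1 zero) t) , 1ℝ
  positionOf (outer (suc j) t _ _) = 1ℝ + 1 / suc (size-1 (suc j)) , fromℚ (offset (size-1 (suc j)) t)

  -- The side 1/(i+1), the second component of `P i`, has to run along the row: horizontally in
  -- level 0, vertically in the others.
  orientationOf : ∀ {k} → View k → Orientation
  orientationOf (inner f _)           = Given.orientation f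
  orientationOf (outer zero    t _ _) = rotated
  orientationOf (outer (suc j) t _ _) = unrotated

  placedOf : ∀ {k} → View k → Rect
  placedOf {k} v = let (w , h) = orient (orientationOf v) (P (suc k)) in rect (positionOf v) w h

  topStrip rightStrip : Rect
  topStrip   = rect (0ℝ , 1ℝ) (ln 2) (1 / n)
  rightStrip = rect (1ℝ , 0ℝ) (1 / n) (ln 2)

  level0⊆topStrip : ∀ {k} t t<M (e : k ≡ size-1 0 ℕ.+ t) → placedOf (outer 0 t t<M e) ⊆ topStrip
  level0⊆topStrip t t<M refl = ⊆-from-edges {placedOf (outer 0 t t<M refl)} {topStrip}
    (pointwise {0ℝ} {fromℚ (offset m t)} λ _ → 0≤offset m t)
    (offset-end m t<M)
    (pointwise {1ℝ} {1ℝ} λ _ → ℚ.≤-refl)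
    -- Across the row, P_i measures 1/i, and i ≥ n.
    (pointwise {1ℝ + 1 / suc (m ℕ.+ t)} {1ℝ + 1 / n} λ _ →
      ℚ.+-monoʳ-≤ 1ℚ (1/-antitone n (suc (m ℕ.+ t)) (ℕ.s≤s (ℕ.m≤m+n m t))))

  -- Level l stays within the distance 1/(2^j n) of the unit square if j < l.
  right-of-level : ∀ {j l} t → j ℕ.< l →
    (1ℚ ℚ.+ + 1 ℚ./ suc (size-1 l)) ℚ.+ + 1 ℚ./ suc (size-1 l ℕ.+ t) ℚ.≤ 1ℚ ℚ.+ + 1 ℚ./ suc (size-1 j)
  right-of-level {j} {l} t j<l = begin
    (1ℚ ℚ.+ + 1 ℚ./ suc (size-1 l)) ℚ.+ + 1 ℚ./ suc (size-1 l ℕ.+ t)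
      ≡⟨ ℚ.+-assoc 1ℚ (+ 1 ℚ./ suc (size-1 l)) (+ 1 ℚ./ suc (size-1 l ℕ.+ t)) ⟩
    1ℚ ℚ.+ (+ 1 ℚ./ suc (size-1 l) ℚ.+ + 1 ℚ./ suc (size-1 l ℕ.+ t))
      -- Both denominators are at least twice `suc (size-1 j)`, so each fraction is at most half of
      -- the bound.
      ≤⟨ ℚ.+-monoʳ-≤ 1ℚ (1/+1/≤1/ (size-1 j) (suc (size-1 l)) (suc (size-1 l ℕ.+ t)) (size-1-double j<l)
           (ℕ.≤-trans (size-1-double j<l) (ℕ.m≤m+n (suc (size-1 l)) t))) ⟩
    1ℚ ℚ.+ + 1 ℚ./ suc (size-1 j) ∎
    where open ℚ.≤-Reasoning

  level⊆rightStrip : ∀ {k} j t t<M (e : k ≡ size-1 (suc j) ℕ.+ t) → placedOf (outer (suc j) t t<M e) ⊆ rightStrip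
  level⊆rightStrip j t t<M refl = ⊆-from-edges {R} {rightStrip}
    (pointwise {1ℝ} {left R} λ _ → ≤+ʳ 1ℚ (+ 1 ℚ./ suc (size-1 (suc j))) (0≤1/ (suc (size-1 (suc j)))))
    -- Compared with level 0, the bound is 1/n, the width of the strip.
    (pointwise {right R} {right rightStrip} λ _ → right-of-level {0} {suc j} t (ℕ.s≤s ℕ.z≤n))
    (pointwise {0ℝ} {bottom R} λ _ → 0≤offset (size-1 (suc j)) t)
    (offset-end (size-1 (suc j)) t<M)
    where
    R = placedOf (outer (suc j) t t<M refl)

  inner⊆square : ∀ {k} f (e : k ≡ toℕ f) → placedOf (inner f e) ⊆ square 1ℝ
  inner⊆square f refl = Given.inside f

  -- Everything lies in the container.

  container : Rect
  container = square (1ℝ + 1 / n)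

  0≤1/n : 0ℚ ℚ.≤ + 1 ℚ./ n
  0≤1/n = 0≤1/ n

  0≤1 : 0ℝ ≤ 1ℝ
  0≤1 = pointwise {0ℝ} {1ℝ} λ _ → 0≤1/ 1

  0≤0 : 0ℝ ≤ 0ℝ
  0≤0 = pointwise {0ℝ} {0ℝ} λ _ → ℚ.≤-refl

  1ℚ≤0+[1+1/n] : 1ℚ ℚ.≤ 0ℚ ℚ.+ (1ℚ ℚ.+ + 1 ℚ./ n)
  1ℚ≤0+[1+1/n] = subst (1ℚ ℚ.≤_) (sym (ℚ.+-identityˡ (1ℚ ℚ.+ + 1 ℚ./ n))) (≤+ʳ 1ℚ (+ 1 ℚ./ n) 0≤1/n)

  0+1≤side : 0ℝ + 1ℝ ≤ 0ℝ + (1ℝ + 1 / n)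
  0+1≤side = pointwise {0ℝ + 1ℝ} {0ℝ + (1ℝ + 1 / n)} λ _ → 1ℚ≤0+[1+1/n]

  1+1/n≤side : 1ℝ + 1 / n ≤ 0ℝ + (1ℝ + 1 / n)
  1+1/n≤side = pointwise {1ℝ + 1 / n} {0ℝ + (1ℝ + 1 / n)} λ _ →
    ℚ.≤-reflexive (sym (ℚ.+-identityˡ (1ℚ ℚ.+ + 1 ℚ./ n)))

  -- Keeps both strips in the container and the right strip below the top one.
  0+ln2≤1 : 0ℝ + ln 2 ≤ 1ℝ
  0+ln2≤1 = pointwise {0ℝ + ln 2} {1ℝ} λ N →
    subst (ℚ._≤ 1ℚ) (sym (ℚ.+-identityˡ (seq (ln 2) N))) (ln2≤1 N)

  0+ln2≤side : 0ℝ + ln 2 ≤ 0ℝ + (1ℝ + 1 / n)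
  0+ln2≤side = ≤-trans {0ℝ + ln 2} {1ℝ} {0ℝ + (1ℝ + 1 / n)} 0+ln2≤1
    (pointwise {1ℝ} {0ℝ + (1ℝ + 1 / n)} λ _ → 1ℚ≤0+[1+1/n])

  square⊆container : square 1ℝ ⊆ container
  square⊆container = ⊆-from-edges {square 1ℝ} {container} 0≤0 0+1≤side 0≤0 0+1≤side

  topStrip⊆container : topStrip ⊆ container
  topStrip⊆container = ⊆-from-edges {topStrip} {container} 0≤0 0+ln2≤side 0≤1 1+1/n≤side

  rightStrip⊆container : rightStrip ⊆ container
  rightStrip⊆container = ⊆-from-edges {rightStrip} {container} 0≤1 1+1/n≤side 0≤0 0+ln2≤side

  placed⊆container : ∀ {k} (v : View k) → placedOf v ⊆ container
  placed⊆container v@(inner f e) =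
    ⊆-trans {placedOf v} {square 1ℝ} {container} (inner⊆square f e) square⊆container
  placed⊆container v@(outer zero t t<M e) =
    ⊆-trans {placedOf v} {topStrip} {container} (level0⊆topStrip t t<M e) topStrip⊆container
  placed⊆container v@(outer (suc j) t t<M e) =
    ⊆-trans {placedOf v} {rightStrip} {container} (level⊆rightStrip j t t<M e) rightStrip⊆container

  -- Disjointness of the placed rectangles.

  0+1≤1 : 0ℝ + 1ℝ ≤ 1ℝ
  0+1≤1 = pointwise {0ℝ + 1ℝ} {1ℝ} λ _ → ℚ.≤-refl

  inner-outer-disjoint : ∀ {k l} f (e : k ≡ toℕ f) j t t<M (e′ : l ≡ size-1 j ℕ.+ t) →
    DisjointInteriors (placedOf (inner f e)) (placedOf (outer j t t<M e′))
  inner-outer-disjoint f e zero t t<M e′ =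
    disjoint-above {placedOf (inner f e)} {placedOf (outer 0 t t<M e′)} (square 1ℝ) (inner⊆square f e) 0+1≤1
  inner-outer-disjoint f e (suc j) t t<M e′ =
    disjoint-right {placedOf (inner f e)} {R} (square 1ℝ) (inner⊆square f e)
      (≤-trans {0ℝ + 1ℝ} {1ℝ} {left R} 0+1≤1
        (pointwise {1ℝ} {left R} λ _ → ≤+ʳ 1ℚ (+ 1 ℚ./ suc (size-1 (suc j))) (0≤1/ (suc (size-1 (suc j))))))
    where
    R = placedOf (outer (suc j) t t<M e′)

  same-level-disjoint : ∀ {k l} j t t<M (e : k ≡ size-1 j ℕ.+ t) u u<M (e′ : l ≡ size-1 j ℕ.+ u) → t ℕ.< u →
    DisjointInteriors (placedOf (outer j t t<M e)) (placedOf (outer j u u<M e′))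
  same-level-disjoint zero t t<M refl u u<M refl t<u =
    disjoint-right {R} {S} R (λ _ p∈R → p∈R) (pointwise {right R} {left S} λ _ → offset-step m t<u)
    where
    R = placedOf (outer 0 t t<M refl)
    S = placedOf (outer 0 u u<M refl)
  same-level-disjoint (suc j) t t<M refl u u<M refl t<u =
    disjoint-above {R} {S} R (λ _ p∈R → p∈R)
      (pointwise {top R} {bottom S} λ _ → offset-step (size-1 (suc j)) t<u)
    where
    R = placedOf (outer (suc j) t t<M refl)
    S = placedOf (outer (suc j) u u<M refl)

  -- Level 0 lies above the whole right strip. Among the columns in that strip, the later level is
  -- nearer to the square and ends before the earlier one begins.
  levels-disjoint : ∀ {k k′} j t t<M (e : k ≡ size-1 j ℕ.+ t) l u u<M (e′ : k′ ≡ size-1 l ℕ.+ u) → j ℕ.< l →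
    DisjointInteriors (placedOf (outer l u u<M e′)) (placedOf (outer j t t<M e))
  levels-disjoint zero t t<M e (suc l) u u<M e′ _ =
    disjoint-above {placedOf (outer (suc l) u u<M e′)} {placedOf (outer 0 t t<M e)}
      rightStrip (level⊆rightStrip l u u<M e′) 0+ln2≤1
  levels-disjoint (suc j) t t<M refl (suc l) u u<M refl j<l =
    disjoint-right {R} {S} R (λ _ p∈R → p∈R)
      (pointwise {right R} {left S} λ _ → right-of-level {suc j} {suc l} u j<l)
    where
    R = placedOf (outer (suc l) u u<M refl)
    S = placedOf (outer (suc j) t t<M refl)

  -- Levels are compared first, and places only within one level; agreement in both would make the
  -- indices equal.
  outer-disjoint : ∀ {k k′} → k ≢ k′ → ∀ j t t<M (e : k ≡ size-1 j ℕ.+ t) l u u<M (e′ : k′ ≡ size-1 l ℕ.+ u) →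
    Tri (j ℕ.< l) (j ≡ l) (l ℕ.< j) → Tri (t ℕ.< u) (t ≡ u) (u ℕ.< t) →
    DisjointInteriors (placedOf (outer j t t<M e)) (placedOf (outer l u u<M e′))
  outer-disjoint _ j t t<M e l u u<M e′ (tri< j<l _ _) _ =
    disjoint-sym {placedOf (outer l u u<M e′)} {placedOf (outer j t t<M e)} (levels-disjoint j t t<M e l u u<M e′ j<l)
  outer-disjoint _ j t t<M e l u u<M e′ (tri> _ _ l<j) _ = levels-disjoint l u u<M e′ j t t<M e l<j
  outer-disjoint _ j t t<M e j u u<M e′ (tri≈ _ refl _) (tri< t<u _ _) = same-level-disjoint j t t<M e u u<M e′ t<u
  outer-disjoint _ j t t<M e j u u<M e′ (tri≈ _ refl _) (tri> _ _ u<t) =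
    disjoint-sym {placedOf (outer j u u<M e′)} {placedOf (outer j t t<M e)} (same-level-disjoint j u u<M e′ t t<M e u<t)
  outer-disjoint k≢k′ j t t<M e j t _ e′ (tri≈ _ refl _) (tri≈ _ refl _) = contradiction (trans e (sym e′)) k≢k′

  -- Arbitrary views are allowed, so the cases split on constructors without unfolding `view`.
  placed-disjoint : ∀ {k l} → k ≢ l → (v : View k) (w : View l) → DisjointInteriors (placedOf v) (placedOf w)
  placed-disjoint k≢l (inner f refl) (inner g refl) = Given.disjoint f g (k≢l ∘ cong toℕ)
  placed-disjoint k≢l (inner f e) (outer j t t<M e′) = inner-outer-disjoint f e j t t<M e′
  placed-disjoint k≢l v@(outer j t t<M e) w@(inner f e′) =
    disjoint-sym {placedOf w} {placedOf v} (inner-outer-disjoint f e′ j t t<M e)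
  placed-disjoint k≢l (outer j t t<M e) (outer l u u<M e′) =
    outer-disjoint k≢l j t t<M e l u u<M e′ (ℕ.<-cmp j l) (ℕ.<-cmp t u)

  packing : PackingAll container
  packing = record
    { position    = positionOf ∘ view
    ; orientation = orientationOf ∘ view
    ; inside      = placed⊆container ∘ view
    ; disjoint    = λ k l k≢l → placed-disjoint k≢l (view k) (view l)
    }

  -- The used region and its area.

  placed-in-square : ∀ {k} (v : View k) → suc k ℕ.< n → placedOf v ⊆ square 1ℝ
  placed-in-square (inner f e)         _             = inner⊆square f e
  placed-in-square (outer j t t<M refl) (ℕ.s≤s k<m) =
    contradiction (ℕ.≤-trans (m≤size-1 j) (ℕ.m≤m+n (size-1 j) t)) (ℕ.<⇒≱ k<m)

  placed-in-strip : ∀ {k} (v : View k) → n ℕ.≤ suc k → Any (placedOf v ⊆_) (topStrip ∷ rightStrip ∷ [])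
  placed-in-strip (inner f refl)          (ℕ.s≤s m≤k) = contradiction m≤k (ℕ.<⇒≱ (Fin.toℕ<n f))
  placed-in-strip (outer zero t t<M e)    _           = here (level0⊆topStrip t t<M e)
  placed-in-strip (outer (suc j) t t<M e) _           = there (here (level⊆rightStrip j t t<M e))

  0<1/n : 0ℚ ℚ.< + 1 ℚ./ n
  0<1/n = ℚ.positive⁻¹ (+ 1 ℚ./ n) {{ℚ.normalize-pos 1 n}}

  0ℝ<1/n : 0ℝ < 1 / n
  0ℝ<1/n = + 1 ℚ./ n , 0<1/n , 0 , λ _ _ → ℚ.≤-reflexive (ℚ.+-identityˡ (+ 1 ℚ./ n))

  region : UsedRegion n packing
  region = record
    { strips         = topStrip ∷ rightStrip ∷ []
    ; nonDegenerate  = (0<ln2 , 0ℝ<1/n) ∷ (0ℝ<1/n , 0<ln2) ∷ []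
    ; pieces-inside  = square⊆container ∷ topStrip⊆container ∷ rightStrip⊆container ∷ []
    ; nonOverlapping =
          ( disjoint-above {square 1ℝ} {topStrip} (square 1ℝ) (λ _ p∈ → p∈) 0+1≤1
          ∷ disjoint-right {square 1ℝ} {rightStrip} (square 1ℝ) (λ _ p∈ → p∈) 0+1≤1
          ∷ [])
        ∷ ( disjoint-sym {rightStrip} {topStrip}
              (disjoint-above {rightStrip} {topStrip} rightStrip (λ _ p∈ → p∈) 0+ln2≤1)
          ∷ [])
        ∷ []
        ∷ []
    ; in-square      = λ k → placed-in-square (view k)
    ; in-strip       = λ k → placed-in-strip (view k)
    }

  region-area : regionArea region < 1ℝ + 2 / n * (ln 2 + 1 / (2 ℕ.* n))
  -- The area is exactly 1 + (2/n) ln 2, so the gap to the bound is (2/n) · 1/(2n), at every index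
  -- of the approximating sequences.
  region-area = 2/n ℚ.* ε , 0<2/n*ε , 0 , λ N _ → ℚ.≤-reflexive (begin
    1ℚ ℚ.* 1ℚ ℚ.+ (s N ℚ.* 1/n ℚ.+ (1/n ℚ.* s N ℚ.+ 0ℚ)) ℚ.+ 2/n ℚ.* ε
      -- With 2/n split into 1/n + 1/n, the rest is a ring identity.
      ≡⟨ cong (λ c → 1ℚ ℚ.* 1ℚ ℚ.+ (s N ℚ.* 1/n ℚ.+ (1/n ℚ.* s N ℚ.+ 0ℚ)) ℚ.+ c ℚ.* ε) 2/n≡ ⟩
    1ℚ ℚ.* 1ℚ ℚ.+ (s N ℚ.* 1/n ℚ.+ (1/n ℚ.* s N ℚ.+ 0ℚ)) ℚ.+ (1/n ℚ.+ 1/n) ℚ.* ε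
      ≡⟨ rearrange (s N) 1/n ε ⟩
    1ℚ ℚ.+ (1/n ℚ.+ 1/n) ℚ.* (s N ℚ.+ ε)
      ≡⟨ cong (λ c → 1ℚ ℚ.+ c ℚ.* (s N ℚ.+ ε)) 2/n≡ ⟨
    1ℚ ℚ.+ 2/n ℚ.* (s N ℚ.+ ε) ∎)
    where
    open ≡-Reasoning
    s = seq (ln 2)
    1/n 2/n ε : ℚ
    1/n = + 1 ℚ./ n
    2/n = + 2 ℚ./ n
    ε   = + 1 ℚ./ (2 ℕ.* n)
    2/n≡ : 2/n ≡ 1/n ℚ.+ 1/n
    2/n≡ = sym (/-+ 1 1 n)
    0<2/n*ε : 0ℚ ℚ.< 2/n ℚ.* ε
    0<2/n*ε = ℚ.positive⁻¹ (2/n ℚ.* ε)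
      {{ℚ.pos*pos⇒pos 2/n {{ℚ.normalize-pos 2 n}} ε {{ℚ.normalize-pos 1 (2 ℕ.* n)}}}}
    rearrange : ∀ a r e → 1ℚ ℚ.* 1ℚ ℚ.+ (a ℚ.* r ℚ.+ (r ℚ.* a ℚ.+ 0ℚ)) ℚ.+ (r ℚ.+ r) ℚ.* e
                        ≡ 1ℚ ℚ.+ (r ℚ.+ r) ℚ.* (a ℚ.+ e)
    rearrange = solve 3 (λ a r e →
      con 1ℚ :* con 1ℚ :+ (a :* r :+ (r :* a :+ con 0ℚ)) :+ (r :+ r) :* e
        := con 1ℚ :+ (r :+ r) :* (a :+ e)) refl
      where open ℚ-Solver

theorem1 : (n : ℕ) .{{_ : NonZero n}} → 1000 ℕ.≤ n →
    Packing {Fin (n ∸ 1)} (λ k → P (suc (toℕ k))) (square 1ℝ) →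
    Σ[ p ∈ PackingAll (square (1ℝ + 1 / n)) ] Σ[ U ∈ UsedRegion n p ]
    regionArea U < 1ℝ + 2 / n * (ln 2 + (1 / (2 ℕ.* n)) {{m*n≢0 2 n}})
-- Matching on `suc m` lets `n ∸ 1` compute to `m`.
theorem1 (suc m) _ given = packing , region , region-area
  where open Construction m given
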